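{- The generalized elementary symmetric functions $e^{(p)}_a$ satisfy the following Newton's identity: for all $a,b\in\mathbb Z$, $$\sum_{p=-\infty}^{\infty}(-1)^{a-p}\,h^{(p)}_b\,e^{(-p)}_a=\delta_{a,b}.$$
   Context: Setting. Let $B=\mathbb C[h^{(0)}_1,h^{(0)}_2,\dots]$ be the polynomial ring in independent variables $h^{(0)}_k$ ($k>0$), with $h^{(0)}_0=1$ and $h^{(0)}_k=0$ for $k<0$. $B$ is graded by $\deg h^{(0)}_n=n$, and $B^{\le n}$ is the sum of the homogeneous components of degree $\le n$. Let $\{h^{(r)}_k\}_{k,r\in\mathbb Z}$ be a family of elements of $B$ (extending the $h^{(0)}_k$) with $h^{(r)}_k\in B^{\le k+r}$, $h^{(k)}_{ -k}=1$ for all $k\in\mathbb Z$, and $h^{(r)}_k=0$ whenever $k+r<0$. It is also required that the polynomials $s_\lambda=\det[h^{(j-1)}_{\lambda_i-i+1}]_{1\le i,j\le l}$, over all partitions $\lambda=(\lambda_1\ge\dots\ge\lambda_l\ge0)$, form a linear basis of $B$. Generalized elementary symmetric functions: for $a,p\in\mathbb Z$, $e^{(p)}_a=0$ if $p<a$, $e^{(p)}_a=1$ if $p=a$, and $e^{(p)}_a=\det\left[h^{(-p+j)}_{p+1-i}\right]_{1\le i,j\le p-a}$ if $p>a$. The sum in the claim has only finitely many nonzero terms (those with $-b\le p\le -a$). -}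

module Defs where

open import Algebra.Bundles using (CommutativeRing)
import Algebra.Properties.Semiring.Exp as Exp
import Algebra.Properties.Semiring.Sum as Sum
open import Data.Bool.Base using (if_then_else_)
open import Data.Fin.Base as Fin using (Fin; toℕ; punchIn)
open import Data.Integer.Base as ℤ using (ℤ; +_; -[1+_]; 0ℤ; 1ℤ)
import Data.Integer.Properties as ℤ
open import Data.List.Base as List using (List; []; _∷_; foldr; length; lookup)
open import Data.List.Relation.Unary.All using (All)
open import Data.List.Relation.Unary.Linked using (Linked)
open import Data.List.Relation.Unary.Unique.Propositional using (Unique)
open import Data.Nat.Base as ℕ using (ℕ; zero; suc; NonZero; _⊔_)
import Data.Nat.Properties as ℕ
open import Data.Product.Base using (∃-syntax; _×_; _,_; proj₁; proj₂)
open import Data.Rational.Base as ℚ using (ℚ; 0ℚ; 1ℚ; ½; ∣_∣)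
import Data.Rational.Properties as ℚ
import Data.Rational.Solver as ℚSolver
open import Level using (0ℓ)
import Level
open import Relation.Binary.PropositionalEquality
  using (_≡_; refl; sym; trans; cong; subst; subst₂)
open import Relation.Nullary.Decidable using (does)

------------------------------------------------------------------------
-- The real numbers, as Cauchy sequences of rationals

-- On Cauchy sequences this says that x - y tends to zero; on the diagonal
-- it is the Cauchy condition itself.

record _∼_ (x y : ℕ → ℚ) : Set where
  no-eta-equality
  constructor within
  field
    modulus : ∀ ε → 0ℚ ℚ.< ε →
      ∃[ N ] (∀ m n → N ℕ.≤ m → N ℕ.≤ n → ∣ x m ℚ.- y n ∣ ℚ.< ε)

open _∼_ public

record ℝ : Set where
  constructor real
  field
    seq    : ℕ → ℚ
    cauchy : seq ∼ seq

open ℝ public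

infix 4 _≈ℝ_

record _≈ℝ_ (x y : ℝ) : Set where
  constructor close
  field
    closeness : seq x ∼ seq y

open _≈ℝ_ public

private abstract
  half : ∀ ε → 0ℚ ℚ.< ε → 0ℚ ℚ.< ½ ℚ.* ε
  half ε 0<ε = subst (ℚ._< ½ ℚ.* ε) (ℚ.*-zeroʳ ½) (ℚ.*-monoʳ-<-pos ½ 0<ε)

  halves : ∀ ε → ½ ℚ.* ε ℚ.+ ½ ℚ.* ε ≡ ε
  halves ε = trans (sym (ℚ.*-distribʳ-+ ε ½ ½)) (ℚ.*-identityˡ ε)

  -- |a + b| < ε as soon as |a|, |b| < ε/2.
  split : ∀ {ε a b c} → c ≡ a ℚ.+ b →
          ∣ a ∣ ℚ.< ½ ℚ.* ε → ∣ b ∣ ℚ.< ½ ℚ.* ε → ∣ c ∣ ℚ.< ε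
  split {ε} {a} {b} refl p q = subst (∣ a ℚ.+ b ∣ ℚ.<_) (halves ε)
    (ℚ.≤-<-trans (ℚ.∣p+q∣≤∣p∣+∣q∣ a b) (ℚ.+-mono-< p q))

  swap-minus : ∀ p q → ∣ p ℚ.- q ∣ ≡ ∣ q ℚ.- p ∣
  swap-minus p q = trans (cong ∣_∣ (lemma p q)) (ℚ.∣-p∣≡∣p∣ (q ℚ.- p))
    where
    open ℚSolver.+-*-Solver
    lemma : ∀ p q → p ℚ.- q ≡ ℚ.- (q ℚ.- p)
    lemma = solve 2 (λ p q → p :- q := :- (q :- p)) refl

  left : ∀ M N {m} → M ⊔ N ℕ.≤ m → M ℕ.≤ m
  left M N = ℕ.≤-trans (ℕ.m≤m⊔n M N)

  right : ∀ M N {m} → M ⊔ N ℕ.≤ m → N ℕ.≤ m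
  right M N = ℕ.≤-trans (ℕ.m≤n⊔m M N)

  ∼-sym : ∀ {x y} → x ∼ y → y ∼ x
  modulus (∼-sym {x} {y} x∼y) ε 0<ε with modulus x∼y ε 0<ε
  ... | N , f = N , λ m n N≤m N≤n →
    subst (ℚ._< ε) (swap-minus (x n) (y m)) (f n m N≤n N≤m)

  ∼-trans : ∀ {x y z} → x ∼ y → y ∼ z → x ∼ z
  modulus (∼-trans {x} {y} {z} x∼y y∼z) ε 0<ε
    with modulus x∼y (½ ℚ.* ε) (half ε 0<ε) | modulus y∼z (½ ℚ.* ε) (half ε 0<ε)
  ... | M , f | N , g = M ⊔ N , λ m n p q →
    split (lemma (x m) (y (M ⊔ N)) (z n))
      (f m (M ⊔ N) (left M N p) (ℕ.m≤m⊔n M N))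
      (g (M ⊔ N) n (ℕ.m≤n⊔m M N) (right M N q))
    where
    open ℚSolver.+-*-Solver
    lemma : ∀ a b c → a ℚ.- c ≡ (a ℚ.- b) ℚ.+ (b ℚ.- c)
    lemma = solve 3 (λ a b c → a :- c := (a :- b) :+ (b :- c)) refl

  ∼-pointwise : ∀ {x y} → x ∼ x → (∀ n → x n ≡ y n) → x ∼ y
  modulus (∼-pointwise {x} x∼x eq) ε 0<ε with modulus x∼x ε 0<ε
  ... | N , f = N , λ m n p q →
    subst (λ t → ∣ x m ℚ.- t ∣ ℚ.< ε) (eq n) (f m n p q)

  ∼-const : ∀ q → (λ _ → q) ∼ (λ _ → q)
  modulus (∼-const q) ε 0<ε = 0 , λ _ _ _ _ →
    subst (ℚ._< ε) (sym (cong ∣_∣ (ℚ.+-inverseʳ q))) 0<ε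

  ∼-+ : ∀ {x x′ y y′} → x ∼ x′ → y ∼ y′ →
        (λ n → x n ℚ.+ y n) ∼ (λ n → x′ n ℚ.+ y′ n)
  modulus (∼-+ {x} {x′} {y} {y′} x∼x′ y∼y′) ε 0<ε
    with modulus x∼x′ (½ ℚ.* ε) (half ε 0<ε) | modulus y∼y′ (½ ℚ.* ε) (half ε 0<ε)
  ... | M , f | N , g = M ⊔ N , λ m n p q →
    split (lemma (x m) (y m) (x′ n) (y′ n))
      (f m n (left M N p) (left M N q))
      (g m n (right M N p) (right M N q))
    where
    open ℚSolver.+-*-Solver
    lemma : ∀ a b c d → (a ℚ.+ b) ℚ.- (c ℚ.+ d) ≡ (a ℚ.- c) ℚ.+ (b ℚ.- d)
    lemma = solve 4 (λ a b c d →
      (a :+ b) :- (c :+ d) := (a :- c) :+ (b :- d)) refl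

  ∼-neg : ∀ {x y} → x ∼ y → (λ n → ℚ.- x n) ∼ (λ n → ℚ.- y n)
  modulus (∼-neg {x} {y} x∼y) ε 0<ε with modulus x∼y ε 0<ε
  ... | N , f = N , λ m n p q →
    subst (ℚ._< ε) (trans (swap-minus (x m) (y n))
                          (cong ∣_∣ (lemma (x m) (y n)))) (f m n p q)
    where
    open ℚSolver.+-*-Solver
    lemma : ∀ a b → b ℚ.- a ≡ (ℚ.- a) ℚ.- (ℚ.- b)
    lemma = solve 2 (λ a b → b :- a := (:- a) :- (:- b)) refl

  eventually-bounded : ∀ {x y} → x ∼ y →
    ∃[ K ] (0ℚ ℚ.< K) × (∃[ N ] (∀ m → N ℕ.≤ m → ∣ x m ∣ ℚ.≤ K))
  eventually-bounded {x} {y} x∼y with modulus x∼y 1ℚ (ℚ.positive⁻¹ 1ℚ)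
  ... | N , f = 1ℚ ℚ.+ ∣ y N ∣
              , ℚ.+-mono-<-≤ (ℚ.positive⁻¹ 1ℚ) (ℚ.0≤∣p∣ (y N))
              , N , λ m N≤m → subst (λ t → ∣ t ∣ ℚ.≤ 1ℚ ℚ.+ ∣ y N ∣)
                  (lemma (x m) (y N))
                  (ℚ.≤-trans (ℚ.∣p+q∣≤∣p∣+∣q∣ (x m ℚ.- y N) (y N))
                    (ℚ.+-monoˡ-≤ ∣ y N ∣ (ℚ.<⇒≤ (f m N N≤m ℕ.≤-refl))))
    where
    open ℚSolver.+-*-Solver
    lemma : ∀ a b → (a ℚ.- b) ℚ.+ b ≡ a
    lemma = solve 2 (λ a b → (a :- b) :+ b := a) refl

  -- |a| ≤ K and |b| < ε/K give |a b| < ε.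
  scale : ∀ K → 0ℚ ℚ.< K → ∀ ε → 0ℚ ℚ.< ε →
          ∃[ δ ] (0ℚ ℚ.< δ) ×
            (∀ {a b} → ∣ a ∣ ℚ.≤ K → ∣ b ∣ ℚ.< δ → ∣ a ℚ.* b ∣ ℚ.< ε)
  scale K 0<K ε 0<ε = δ , 0<δ , λ {a} {b} a≤K b<δ →
    subst₂ ℚ._<_ (sym (ℚ.∣p*q∣≡∣p∣*∣q∣ a b)) Kδ≡ε
      (ℚ.≤-<-trans
        (ℚ.*-monoʳ-≤-nonNeg ∣ b ∣ {{ℚ.nonNegative (ℚ.0≤∣p∣ b)}} a≤K)
        (ℚ.*-monoʳ-<-pos K b<δ))
    where
    instance
      K>0 : ℚ.Positive K
      K>0 = ℚ.positive 0<K
      K≢0 : ℚ.NonZero K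
      K≢0 = ℚ.pos⇒nonZero K
      K⁻¹>0 : ℚ.Positive (ℚ.1/ K)
      K⁻¹>0 = ℚ.1/pos⇒pos K
    δ : ℚ
    δ = ℚ.1/ K ℚ.* ε
    0<δ : 0ℚ ℚ.< δ
    0<δ = subst (ℚ._< δ) (ℚ.*-zeroʳ (ℚ.1/ K)) (ℚ.*-monoʳ-<-pos (ℚ.1/ K) 0<ε)
    Kδ≡ε : K ℚ.* δ ≡ ε
    Kδ≡ε = trans (sym (ℚ.*-assoc K (ℚ.1/ K) ε))
             (trans (cong (ℚ._* ε) (ℚ.*-inverseʳ K)) (ℚ.*-identityˡ ε))

  ∼-* : ∀ {x x′ y y′} → x ∼ x′ → y ∼ y′ →
        (λ n → x n ℚ.* y n) ∼ (λ n → x′ n ℚ.* y′ n)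
  modulus (∼-* {x} {x′} {y} {y′} x∼x′ y∼y′) ε 0<ε =
    let K₁ , 0<K₁ , N₁ , b₁ = eventually-bounded x∼x′
        K₂ , 0<K₂ , N₂ , b₂ = eventually-bounded (∼-sym y∼y′)
        δ₁ , 0<δ₁ , s₁ = scale K₁ 0<K₁ (½ ℚ.* ε) (half ε 0<ε)
        δ₂ , 0<δ₂ , s₂ = scale K₂ 0<K₂ (½ ℚ.* ε) (half ε 0<ε)
        M₁ , f = modulus y∼y′ δ₁ 0<δ₁
        M₂ , g = modulus x∼x′ δ₂ 0<δ₂
        N = N₁ ⊔ N₂
        M = M₁ ⊔ M₂
    in N ⊔ M , λ m n p q →
       split (lemma (x m) (y m) (x′ n) (y′ n))
         (s₁ (b₁ m (left N₁ N₂ (left N M p)))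
             (f m n (left M₁ M₂ (right N M p)) (left M₁ M₂ (right N M q))))
         (s₂ (b₂ n (right N₁ N₂ (left N M q)))
             (g m n (right M₁ M₂ (right N M p)) (right M₁ M₂ (right N M q))))
    where
    open ℚSolver.+-*-Solver
    lemma : ∀ a b c d → (a ℚ.* b) ℚ.- (c ℚ.* d)
                      ≡ a ℚ.* (b ℚ.- d) ℚ.+ d ℚ.* (a ℚ.- c)
    lemma = solve 4 (λ a b c d →
      (a :* b) :- (c :* d) := a :* (b :- d) :+ d :* (a :- c)) refl

infixl 6 _+ℝ_
infixl 7 _*ℝ_
infix  8 -ℝ_

_+ℝ_ _*ℝ_ : ℝ → ℝ → ℝ
real x cx +ℝ real y cy = real (λ n → x n ℚ.+ y n) (∼-+ cx cy)
real x cx *ℝ real y cy = real (λ n → x n ℚ.* y n) (∼-* cx cy)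

-ℝ_ : ℝ → ℝ
-ℝ real x cx = real (λ n → ℚ.- x n) (∼-neg cx)

0ℝ 1ℝ : ℝ
0ℝ = real (λ _ → 0ℚ) (∼-const 0ℚ)
1ℝ = real (λ _ → 1ℚ) (∼-const 1ℚ)

private abstract
  pointwise : ∀ x y → (∀ n → seq x n ≡ seq y n) → x ≈ℝ y
  pointwise x y eq = close (∼-pointwise (cauchy x) eq)

ℝ-commutativeRing : CommutativeRing 0ℓ 0ℓ
ℝ-commutativeRing = record
  { Carrier = ℝ ; _≈_ = _≈ℝ_ ; _+_ = _+ℝ_ ; _*_ = _*ℝ_ ; -_ = -ℝ_
  ; 0# = 0ℝ ; 1# = 1ℝ
  ; isCommutativeRing = record
    { isRing = record
      { +-isAbelianGroup = record
        { isGroup = record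
          { isMonoid = record
            { isSemigroup = record
              { isMagma = record
                { isEquivalence = record
                  { refl  = λ {x} → close (cauchy x)
                  ; sym   = λ p → close (∼-sym (closeness p))
                  ; trans = λ p q → close (∼-trans (closeness p) (closeness q))
                  }
                ; ∙-cong = λ p q → close (∼-+ (closeness p) (closeness q))
                }
              ; assoc = λ x y z → pointwise (x +ℝ y +ℝ z) (x +ℝ (y +ℝ z))
                  λ n → ℚ.+-assoc (seq x n) (seq y n) (seq z n)
              }
            ; identity =
                (λ x → pointwise (0ℝ +ℝ x) x λ n → ℚ.+-identityˡ (seq x n))
              , (λ x → pointwise (x +ℝ 0ℝ) x λ n → ℚ.+-identityʳ (seq x n))
            }
          ; inverse =
              (λ x → pointwise (-ℝ x +ℝ x) 0ℝ λ n → ℚ.+-inverseˡ (seq x n))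
            , (λ x → pointwise (x +ℝ -ℝ x) 0ℝ λ n → ℚ.+-inverseʳ (seq x n))
          ; ⁻¹-cong = λ p → close (∼-neg (closeness p))
          }
        ; comm = λ x y → pointwise (x +ℝ y) (y +ℝ x)
            λ n → ℚ.+-comm (seq x n) (seq y n)
        }
      ; *-cong = λ p q → close (∼-* (closeness p) (closeness q))
      ; *-assoc = λ x y z → pointwise (x *ℝ y *ℝ z) (x *ℝ (y *ℝ z))
          λ n → ℚ.*-assoc (seq x n) (seq y n) (seq z n)
      ; *-identity =
          (λ x → pointwise (1ℝ *ℝ x) x λ n → ℚ.*-identityˡ (seq x n))
        , (λ x → pointwise (x *ℝ 1ℝ) x λ n → ℚ.*-identityʳ (seq x n))
      ; distrib =
          (λ x y z → pointwise (x *ℝ (y +ℝ z)) (x *ℝ y +ℝ x *ℝ z)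
            λ n → ℚ.*-distribˡ-+ (seq x n) (seq y n) (seq z n))
        , (λ x y z → pointwise ((y +ℝ z) *ℝ x) (y *ℝ x +ℝ z *ℝ x)
            λ n → ℚ.*-distribʳ-+ (seq x n) (seq y n) (seq z n))
      }
    ; *-comm = λ x y → pointwise (x *ℝ y) (y *ℝ x)
        λ n → ℚ.*-comm (seq x n) (seq y n)
    }
  }

------------------------------------------------------------------------
-- The complex numbers; the pair (a , b) is a + b i

ℂ : Set
ℂ = ℝ × ℝ

ℂ-commutativeRing : CommutativeRing 0ℓ 0ℓ
ℂ-commutativeRing = record
  { Carrier = ℂ
  ; _≈_ = λ (a , b) (c , d) → a ≈ c × b ≈ d
  ; _+_ = λ (a , b) (c , d) → a + c , b + d
  ; _*_ = λ (a , b) (c , d) → a * c - b * d , a * d + b * c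
  ; -_  = λ (a , b) → - a , - b
  ; 0#  = 0# , 0#
  ; 1#  = 1# , 0#
  ; isCommutativeRing = record
    { isRing = record
      { +-isAbelianGroup = record
        { isGroup = record
          { isMonoid = record
            { isSemigroup = record
              { isMagma = record
                { isEquivalence = record
                  { refl  = ≈-refl , ≈-refl
                  ; sym   = λ (p , q) → ≈-sym p , ≈-sym q
                  ; trans = λ (p , q) (r , s) → ≈-trans p r , ≈-trans q s
                  }
                ; ∙-cong = λ (p , q) (r , s) → +-cong p r , +-cong q s
                }
              ; assoc = λ (a , b) (c , d) (e , f) →
                  +-assoc a c e , +-assoc b d f
              }
            ; identity = (λ (a , b) → +-identityˡ a , +-identityˡ b)
                       , (λ (a , b) → +-identityʳ a , +-identityʳ b)
            }
          ; inverse = (λ (a , b) → -‿inverseˡ a , -‿inverseˡ b)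
                    , (λ (a , b) → -‿inverseʳ a , -‿inverseʳ b)
          ; ⁻¹-cong = λ (p , q) → -‿cong p , -‿cong q
          }
        ; comm = λ (a , b) (c , d) → +-comm a c , +-comm b d
        }
      ; *-cong = λ (p , q) (r , s) →
            +-cong (*-cong p r) (-‿cong (*-cong q s))
          , +-cong (*-cong p s) (*-cong q r)
      ; *-assoc = λ (a , b) (c , d) (e , f) →
            (pointwise ((a * c - b * d) * e - (a * d + b * c) * f)
                       (a * (c * e - d * f) - b * (c * f + d * e))
              λ n → assoc-re (seq a n) (seq b n) (seq c n)
                             (seq d n) (seq e n) (seq f n))
          , (pointwise ((a * c - b * d) * f + (a * d + b * c) * e)
                       (a * (c * f + d * e) + b * (c * e - d * f))
              λ n → assoc-im (seq a n) (seq b n) (seq c n)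
                             (seq d n) (seq e n) (seq f n))
      ; *-identity =
            (λ (a , b) →
                pointwise (1# * a - 0# * b) a (λ n → idˡ-re (seq a n) (seq b n))
              , pointwise (1# * b + 0# * a) b (λ n → idˡ-im (seq a n) (seq b n)))
          , (λ (a , b) →
                pointwise (a * 1# - b * 0#) a (λ n → idʳ-re (seq a n) (seq b n))
              , pointwise (a * 0# + b * 1#) b (λ n → idʳ-im (seq a n) (seq b n)))
      ; distrib =
            (λ (a , b) (c , d) (e , f) →
                (pointwise (a * (c + e) - b * (d + f))
                           ((a * c - b * d) + (a * e - b * f))
                  λ n → distˡ-re (seq a n) (seq b n) (seq c n)
                                 (seq d n) (seq e n) (seq f n))
              , (pointwise (a * (d + f) + b * (c + e))
                           ((a * d + b * c) + (a * f + b * e))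
                  λ n → distˡ-im (seq a n) (seq b n) (seq c n)
                                 (seq d n) (seq e n) (seq f n)))
          , (λ (a , b) (c , d) (e , f) →
                (pointwise ((c + e) * a - (d + f) * b)
                           ((c * a - d * b) + (e * a - f * b))
                  λ n → distʳ-re (seq a n) (seq b n) (seq c n)
                                 (seq d n) (seq e n) (seq f n))
              , (pointwise ((c + e) * b + (d + f) * a)
                           ((c * b + d * a) + (e * b + f * a))
                  λ n → distʳ-im (seq a n) (seq b n) (seq c n)
                                 (seq d n) (seq e n) (seq f n)))
      }
    ; *-comm = λ (a , b) (c , d) →
          (pointwise (a * c - b * d) (c * a - d * b)
            λ n → comm-re (seq a n) (seq b n) (seq c n) (seq d n))
        , (pointwise (a * d + b * c) (c * b + d * a)
            λ n → comm-im (seq a n) (seq b n) (seq c n) (seq d n))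
    }
  }
  where
  open CommutativeRing ℝ-commutativeRing
    renaming (refl to ≈-refl; sym to ≈-sym; trans to ≈-trans)
  open ℚSolver.+-*-Solver

  assoc-re = solve 6 (λ a b c d e f →
    (a :* c :- b :* d) :* e :- (a :* d :+ b :* c) :* f
      := a :* (c :* e :- d :* f) :- b :* (c :* f :+ d :* e)) refl
  assoc-im = solve 6 (λ a b c d e f →
    (a :* c :- b :* d) :* f :+ (a :* d :+ b :* c) :* e
      := a :* (c :* f :+ d :* e) :+ b :* (c :* e :- d :* f)) refl
  idˡ-re = solve 2 (λ a b → con 1ℚ :* a :- con 0ℚ :* b := a) refl
  idˡ-im = solve 2 (λ a b → con 1ℚ :* b :+ con 0ℚ :* a := b) refl
  idʳ-re = solve 2 (λ a b → a :* con 1ℚ :- b :* con 0ℚ := a) refl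
  idʳ-im = solve 2 (λ a b → a :* con 0ℚ :+ b :* con 1ℚ := b) refl
  distˡ-re = solve 6 (λ a b c d e f →
    a :* (c :+ e) :- b :* (d :+ f)
      := (a :* c :- b :* d) :+ (a :* e :- b :* f)) refl
  distˡ-im = solve 6 (λ a b c d e f →
    a :* (d :+ f) :+ b :* (c :+ e)
      := (a :* d :+ b :* c) :+ (a :* f :+ b :* e)) refl
  distʳ-re = solve 6 (λ a b c d e f →
    (c :+ e) :* a :- (d :+ f) :* b
      := (c :* a :- d :* b) :+ (e :* a :- f :* b)) refl
  distʳ-im = solve 6 (λ a b c d e f →
    (c :+ e) :* b :+ (d :+ f) :* a
      := (c :* b :+ d :* a) :+ (e :* b :+ f :* a)) refl
  comm-re = solve 4 (λ a b c d →
    a :* c :- b :* d := c :* a :- d :* b) refl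
  comm-im = solve 4 (λ a b c d →
    a :* d :+ b :* c := c :* b :+ d :* a) refl

------------------------------------------------------------------------
-- The graded ring K[x₁, x₂, …], deg xₙ = n, with the elements xₙ = h⁽⁰⁾ₙ

module GradedPolynomials {c ℓ} (K : CommutativeRing c ℓ) where

  private module K = CommutativeRing K

  infixl 6 _⊕_
  infixl 7 _⊗_
  infix  8 ⊖_
  infix  4 _≋_ _∈B≤_

  data B : Set c where
    con     : K.Carrier → B
    var     : (n : ℕ) → .{{NonZero n}} → B
    _⊕_ _⊗_ : B → B → B
    ⊖_      : B → B

  -- Polynomial expressions are taken up to the least congruence making B a
  -- commutative ring and con a ring homomorphism, i.e. B is the free
  -- commutative K-algebra on the variables.

  data _≋_ : B → B → Set (c Level.⊔ ℓ) where
    ≋-refl  : ∀ {p} → p ≋ p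
    ≋-sym   : ∀ {p q} → p ≋ q → q ≋ p
    ≋-trans : ∀ {p q r} → p ≋ q → q ≋ r → p ≋ r

    ⊕-cong   : ∀ {p p′ q q′} → p ≋ p′ → q ≋ q′ → p ⊕ q ≋ p′ ⊕ q′
    ⊗-cong   : ∀ {p p′ q q′} → p ≋ p′ → q ≋ q′ → p ⊗ q ≋ p′ ⊗ q′
    ⊖-cong   : ∀ {p p′} → p ≋ p′ → ⊖ p ≋ ⊖ p′
    con-cong : ∀ {a b} → a K.≈ b → con a ≋ con b

    con-⊕ : ∀ a b → con (a K.+ b) ≋ con a ⊕ con b
    con-⊗ : ∀ a b → con (a K.* b) ≋ con a ⊗ con b

    ⊕-assoc     : ∀ p q r → (p ⊕ q) ⊕ r ≋ p ⊕ (q ⊕ r)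
    ⊕-comm      : ∀ p q → p ⊕ q ≋ q ⊕ p
    ⊕-identityˡ : ∀ p → con K.0# ⊕ p ≋ p
    ⊖-inverseˡ  : ∀ p → ⊖ p ⊕ p ≋ con K.0#
    ⊗-assoc     : ∀ p q r → (p ⊗ q) ⊗ r ≋ p ⊗ (q ⊗ r)
    ⊗-comm      : ∀ p q → p ⊗ q ≋ q ⊗ p
    ⊗-identityˡ : ∀ p → con K.1# ⊗ p ≋ p
    ⊗-distribˡ  : ∀ p q r → p ⊗ (q ⊕ r) ≋ p ⊗ q ⊕ p ⊗ r

  B-commutativeRing : CommutativeRing c (c Level.⊔ ℓ)
  B-commutativeRing = record
    { Carrier = B ; _≈_ = _≋_ ; _+_ = _⊕_ ; _*_ = _⊗_ ; -_ = ⊖_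
    ; 0# = con K.0# ; 1# = con K.1#
    ; isCommutativeRing = record
      { isRing = record
        { +-isAbelianGroup = record
          { isGroup = record
            { isMonoid = record
              { isSemigroup = record
                { isMagma = record
                  { isEquivalence = record
                    { refl = ≋-refl ; sym = ≋-sym ; trans = ≋-trans }
                  ; ∙-cong = ⊕-cong
                  }
                ; assoc = ⊕-assoc
                }
              ; identity = ⊕-identityˡ
                         , λ p → ≋-trans (⊕-comm p _) (⊕-identityˡ p)
              }
            ; inverse = ⊖-inverseˡ
                      , λ p → ≋-trans (⊕-comm p _) (⊖-inverseˡ p)
            ; ⁻¹-cong = ⊖-cong
            }
          ; comm = ⊕-comm
          }
        ; *-cong = ⊗-cong
        ; *-assoc = ⊗-assoc
        ; *-identity = ⊗-identityˡ
                     , λ p → ≋-trans (⊗-comm p _) (⊗-identityˡ p)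
        ; distrib = ⊗-distribˡ
                  , λ p q r → ≋-trans (⊗-comm (q ⊕ r) p)
                      (≋-trans (⊗-distribˡ p q r)
                        (⊕-cong (⊗-comm p q) (⊗-comm p r)))
        }
      ; *-comm = ⊗-comm
      }
    }

  -- Homogeneous d is the component of degree d.

  data Homogeneous : ℕ → B → Set (c Level.⊔ ℓ) where
    hom-con  : ∀ a → Homogeneous 0 (con a)
    hom-var  : ∀ n .{{_ : NonZero n}} → Homogeneous n (var n)
    hom-zero : ∀ {d} → Homogeneous d (con K.0#)
    hom-⊕    : ∀ {d p q} → Homogeneous d p → Homogeneous d q →
               Homogeneous d (p ⊕ q)
    hom-⊗    : ∀ {d e p q} → Homogeneous d p → Homogeneous e q →
               Homogeneous (d ℕ.+ e) (p ⊗ q)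
    hom-≋    : ∀ {d p q} → p ≋ q → Homogeneous d p → Homogeneous d q

  -- p ∈B≤ n: p is a sum of homogeneous elements of degree ≤ n, so that only
  -- zero qualifies when n is negative.

  data _∈B≤_ : B → ℤ → Set (c Level.⊔ ℓ) where
    zero-∈ : ∀ {n} → con K.0# ∈B≤ n
    hom-∈  : ∀ {n d p} → + d ℤ.≤ n → Homogeneous d p → p ∈B≤ n
    ⊕-∈    : ∀ {n p q} → p ∈B≤ n → q ∈B≤ n → p ⊕ q ∈B≤ n
    ≋-∈    : ∀ {n p q} → p ≋ q → p ∈B≤ n → q ∈B≤ n

  combination : ∀ {i} {I : Set i} → (I → B) → List (K.Carrier × I) → B
  combination v = foldr (λ (a , i) p → con a ⊗ v i ⊕ p) (con K.0#)

  record IsLinearBasis {i} {I : Set i} (v : I → B) :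
                       Set (i Level.⊔ c Level.⊔ ℓ) where
    field
      spanning    : ∀ p → ∃[ t ] (combination v t ≋ p)
      independent : ∀ t → Unique (List.map proj₂ t) →
                    combination v t ≋ con K.0# →
                    All (λ (a , _) → a K.≈ K.0#) t

------------------------------------------------------------------------
-- Partitions are listed without zero parts, so that each occurs once. The
-- proofs are irrelevant: partitions with the same parts are equal.

record Partition : Set where
  constructor partition
  field
    parts       : List ℕ
    .decreasing : Linked ℕ._≥_ parts
    .positive   : All (0 ℕ.<_) parts

open Partition public

------------------------------------------------------------------------
-- Generalized complete and elementary symmetric functions

module SymmetricFunctions {c ℓ} (K : CommutativeRing c ℓ) where

  open GradedPolynomials K public

  private
    module K = CommutativeRing K
    module R = CommutativeRing B-commutativeRing

  open Sum R.semiring using (sum)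
  open Exp R.semiring using (_^_)

  0B 1B : B
  0B = R.0#
  1B = R.1#

  -- (-1)ᵏ = (-1)^|k| for every integer k.

  sgn : ℤ → B
  sgn k = (⊖ 1B) ^ ℤ.∣ k ∣

  -- Laplace expansion along the first row.

  det : ∀ {n} → (Fin n → Fin n → B) → B
  det {zero}  A = 1B
  det {suc n} A = sum λ j →
    sgn (+ toℕ j) ⊗ (A Fin.zero j ⊗ det λ i k → A (Fin.suc i) (punchIn j k))

  h⁰ : ℤ → B
  h⁰ (+ zero)    = 1B
  h⁰ (+ (suc n)) = var (suc n)
  h⁰ -[1+ n ]    = 0B

  -- Throughout, h r k stands for h⁽ʳ⁾ₖ. Matrix indices i, j : Fin n start at 0,
  -- so the row and column numbers of the usual formulas are 1 + toℕ i and
  -- 1 + toℕ j.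

  s : (ℤ → ℤ → B) → Partition → B
  s h π = det {length (parts π)} λ i j →
    h (+ toℕ j) (+ lookup (parts π) i ℤ.- + toℕ i)

  record IsAdmissible (h : ℤ → ℤ → B) : Set (c Level.⊔ ℓ) where
    field
      extends : ∀ k → h 0ℤ k ≋ h⁰ k
      degree  : ∀ r k → h r k ∈B≤ k ℤ.+ r
      unit    : ∀ k → h k (ℤ.- k) ≋ 1B
      vanish  : ∀ r k → k ℤ.+ r ℤ.< 0ℤ → h r k ≋ 0B
      basis   : IsLinearBasis (s h)

  -- e h p a stands for e⁽ᵖ⁾ₐ.

  e : (ℤ → ℤ → B) → ℤ → ℤ → B
  e h p a with p ℤ.- a
  ... | -[1+ _ ]  = 0B
  ... | + zero    = 1B
  ... | + (suc m) = det {suc m} λ i j →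
    h (ℤ.- p ℤ.+ + suc (toℕ j)) (p ℤ.+ 1ℤ ℤ.- + suc (toℕ i))

  δ : ℤ → ℤ → B
  δ a b = if does (a ℤ.≟ b) then 1B else 0B

  -- HasSum f x: f has finite support and its values add up to x. The finite
  -- sum runs over p = -N, …, N.

  HasSum : (ℤ → B) → B → Set (c Level.⊔ ℓ)
  HasSum f x = ∃[ N ]
    ( (∀ p → N ℕ.< ℤ.∣ p ∣ → f p ≋ 0B)
    × sum {suc (N ℕ.+ N)} (λ i → f (+ toℕ i ℤ.- + N)) ≋ x )

open SymmetricFunctions ℂ-commutativeRing public

{-# OPTIONS --safe #-}
-- Put U r t = h⁽ʳ⁾₋ₜ; this matrix indexed by ℤ is unitriangular. Then
-- e⁽⁻ᵖ⁾ₐ with -a = p + n is the Hessenberg determinant E p n of the entries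
-- U (p + j) (p + i - 1), 1 ≤ i, j ≤ n, and Newton's identity says that these
-- determinants, with signs, form the inverse of U. Deleting the first row and
-- the j-th column of E p n leaves a block triangular matrix whose upper left
-- block is unitriangular, so the minor is E (p + j) (n - j); the expansion of
-- E p n along its first row is thus the recursion for the inverse.
module Submission where

open import Defs
open import Data.Integer.Base using (ℤ; -_; _-_)

open import Algebra.Bundles using (CommutativeRing)
import Algebra.Properties.Ring as RingProperties
import Algebra.Properties.Semiring.Exp as Exp
import Algebra.Properties.Semiring.Sum as Sum
open import Data.Fin.Base using (Fin; zero; suc; toℕ; punchIn)
import Data.Fin.Properties as Fin
open import Data.Integer.Base
  using (+_; -[1+_]; 0ℤ; 1ℤ; _+_; _<_; _≤_; ∣_∣; +<+; -<+; +≤+; -≤+)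
import Data.Integer.Properties as ℤ
open import Data.Integer.Tactic.RingSolver using (solve-∀)
open import Data.Nat.Base as ℕ using (ℕ; zero; suc; _∸_; s≤s; z≤n)
import Data.Nat.Properties as ℕ
open import Data.Product.Base using (∃-syntax; _,_)
open import Function.Base using (_∘_)
open import Relation.Binary.PropositionalEquality as ≡
  using (_≡_; _≢_; cong; cong₂; subst; subst₂)
open import Relation.Nullary.Decidable using (yes; no)
open import Relation.Nullary.Negation using (contradiction)
import Relation.Binary.Reasoning.Setoid as SetoidReasoning

private
  module R = CommutativeRing B-commutativeRing

open Sum R.semiring using (sum; sum-cong-≋; sum-replicate-zero; *-distribˡ-sum)
open Exp R.semiring using (_^_)
open RingProperties R.ring
  using (-1*x≈-x; -‿distribˡ-*; -‿distribʳ-*; -‿involutive)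
open SetoidReasoning R.setoid

-- Determinants with zeros in the first column.

sum-zero : ∀ {n} {f : Fin n → B} → (∀ i → f i ≋ 0B) → sum f ≋ 0B
sum-zero {n} f≋0 = R.trans (sum-cong-≋ f≋0) (sum-replicate-zero n)

det-cong : ∀ {n} {A A′ : Fin n → Fin n → B} →
           (∀ i j → A i j ≋ A′ i j) → det A ≋ det A′
det-cong {zero}  A≋A′ = R.refl
det-cong {suc n} A≋A′ = sum-cong-≋ λ j →
  R.*-congˡ {x = sgn (+ toℕ j)} (R.*-cong (A≋A′ zero j)
    (det-cong λ i k → A≋A′ (suc i) (punchIn j k)))

-- Declared ahead of its proof for a mutual induction on the size with `det-firstColumn`: as `det`
-- expands along rows, a zero column acts only through the smaller minors.
det-zeroColumn : ∀ {n} (A : Fin (suc n) → Fin (suc n) → B) →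
                 (∀ i → A i zero ≋ 0B) → det A ≋ 0B

-- Deleting a column other than the first keeps the first column, since `punchIn (suc j) zero` is
-- `zero`; the minor then has a zero column.
laplace-tail : ∀ {n} (A : Fin (suc n) → Fin (suc n) → B) →
               (∀ i → A (suc i) zero ≋ 0B) → ∀ j →
               sgn (+ suc (toℕ j)) ⊗
                 (A zero (suc j) ⊗ det λ i k → A (suc i) (punchIn (suc j) k))
               ≋ 0B
laplace-tail {suc n} A A≋0 j = begin
  sgn (+ suc (toℕ j)) ⊗ (A zero (suc j) ⊗ D)
    ≈⟨ R.*-congˡ {x = sgn (+ suc (toℕ j))} (R.*-congˡ {x = A zero (suc j)}
         (det-zeroColumn (λ i k → A (suc i) (punchIn (suc j) k)) A≋0)) ⟩
  sgn (+ suc (toℕ j)) ⊗ (A zero (suc j) ⊗ 0B)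
    ≈⟨ R.*-congˡ {x = sgn (+ suc (toℕ j))} (R.zeroʳ (A zero (suc j))) ⟩
  sgn (+ suc (toℕ j)) ⊗ 0B
    ≈⟨ R.zeroʳ (sgn (+ suc (toℕ j))) ⟩
  0B ∎
  where
  D : B
  D = det λ i k → A (suc i) (punchIn (suc j) k)

det-firstColumn : ∀ {n} (A : Fin (suc n) → Fin (suc n) → B) →
                  (∀ i → A (suc i) zero ≋ 0B) →
                  det A ≋ A zero zero ⊗ det λ i k → A (suc i) (suc k)
det-firstColumn A A≋0 = begin
  det A                       ≈⟨ R.+-cong (R.*-identityˡ (A zero zero ⊗ D))
                                   (sum-zero (laplace-tail A A≋0)) ⟩
  A zero zero ⊗ D ⊕ 0B        ≈⟨ R.+-identityʳ (A zero zero ⊗ D) ⟩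
  A zero zero ⊗ D             ∎
  where
  D : B
  D = det λ i k → A (suc i) (suc k)

det-zeroColumn A A≋0 = R.trans (det-firstColumn A (A≋0 ∘ suc))
  (R.trans (R.*-congʳ (A≋0 zero)) (R.zeroˡ (det λ i k → A (suc i) (suc k))))

-- Signs.

-- As `sgn` is a power with exponent the absolute value, a step down lowers the exponent for
-- positive `k` and raises it otherwise.
sgn-pred : ∀ k → sgn (k - 1ℤ) ≋ ⊖ sgn k
sgn-pred (+ zero)  = R.*-identityʳ (⊖ 1B)
sgn-pred (+ suc n) = begin
  (⊖ 1B) ^ n             ≈⟨ -‿involutive _ ⟨
  ⊖ (⊖ (⊖ 1B) ^ n)       ≈⟨ R.-‿cong (-1*x≈-x ((⊖ 1B) ^ n)) ⟨
  ⊖ (⊖ 1B ⊗ (⊖ 1B) ^ n)  ∎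
-- Here `k - 1ℤ` computes to `-[1+ suc (n ℕ.+ 0) ]`, whence the transport.
sgn-pred -[1+ n ] = subst (λ m → (⊖ 1B) ^ suc (suc m) ≋ ⊖ (⊖ 1B) ^ suc n)
  (≡.sym (ℕ.+-identityʳ n)) (-1*x≈-x ((⊖ 1B) ^ suc n))

sgn-∸ : ∀ k n → sgn (k - + n) ≋ sgn k ⊗ sgn (+ n)
sgn-∸ k zero    = R.trans (R.reflexive (cong sgn (ℤ.+-identityʳ k)))
                          (R.sym (R.*-identityʳ (sgn k)))
sgn-∸ k (suc n) = begin
  sgn (k - + suc n)            ≈⟨ R.reflexive (cong sgn (shift k (+ n))) ⟩
  sgn (k - + n - 1ℤ)           ≈⟨ sgn-pred (k - + n) ⟩
  ⊖ sgn (k - + n)              ≈⟨ R.-‿cong (sgn-∸ k n) ⟩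
  ⊖ (sgn k ⊗ sgn (+ n))        ≈⟨ -‿distribʳ-* (sgn k) (sgn (+ n)) ⟩
  sgn k ⊗ ⊖ sgn (+ n)          ≈⟨ R.*-congˡ {x = sgn k} (-1*x≈-x (sgn (+ n))) ⟨
  sgn k ⊗ sgn (+ suc n)        ∎
  where
  shift : ∀ k n → k - (1ℤ + n) ≡ k - n - 1ℤ
  shift = solve-∀

sgn-double : ∀ k → sgn (k + k) ≋ 1B
sgn-double k = R.trans (R.reflexive (cong ((⊖ 1B) ^_) (∣k+k∣ k))) (even ∣ k ∣)
  where
  ∣k+k∣ : ∀ k → ∣ k + k ∣ ≡ ∣ k ∣ ℕ.+ ∣ k ∣
  ∣k+k∣ (+ n)    = ≡.refl
  ∣k+k∣ -[1+ n ] = cong suc (≡.sym (ℕ.+-suc n n))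
  even : ∀ n → (⊖ 1B) ^ (n ℕ.+ n) ≋ 1B
  even zero    = R.refl
  even (suc n) = begin
    ⊖ 1B ⊗ (⊖ 1B) ^ (n ℕ.+ suc n)       ≈⟨ R.reflexive (cong (λ m → ⊖ 1B ⊗ (⊖ 1B) ^ m) (ℕ.+-suc n n)) ⟩
    ⊖ 1B ⊗ (⊖ 1B ⊗ (⊖ 1B) ^ (n ℕ.+ n))  ≈⟨ -1*x≈-x _ ⟩
    ⊖ (⊖ 1B ⊗ (⊖ 1B) ^ (n ℕ.+ n))       ≈⟨ R.-‿cong (-1*x≈-x _) ⟩
    ⊖ ⊖ (⊖ 1B) ^ (n ℕ.+ n)              ≈⟨ -‿involutive _ ⟩
    (⊖ 1B) ^ (n ℕ.+ n)                  ≈⟨ even n ⟩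
    1B                                  ∎

-- Kronecker deltas and sums over intervals of integers.

δ-≡ : ∀ {a b} → a ≡ b → δ a b ≋ 1B
δ-≡ {a} {b} a≡b with a ℤ.≟ b
... | yes _  = R.refl
... | no a≢b = contradiction a≡b a≢b

δ-≢ : ∀ {a b} → a ≢ b → δ a b ≋ 0B
δ-≢ {a} {b} a≢b with a ℤ.≟ b
... | yes a≡b = contradiction a≡b a≢b
... | no _    = R.refl

-- Given by start and length, so that adjacent intervals are joined by adding lengths and induction
-- on the length follows `sum`.
segment : (ℤ → B) → ℤ → ℕ → B
segment f s n = sum {n} λ i → f (s + + toℕ i)

segment-+ : ∀ f s m n →
            segment f s (m ℕ.+ n) ≋ segment f s m ⊕ segment f (s + + m) n
segment-+ f s zero    n = begin
  segment f s n               ≈⟨ R.reflexive (cong (λ t → segment f t n) (ℤ.+-identityʳ s)) ⟨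
  segment f (s + 0ℤ) n        ≈⟨ R.+-identityˡ _ ⟨
  0B ⊕ segment f (s + 0ℤ) n   ∎
segment-+ f s (suc m) n = begin
  f (s + 0ℤ) ⊕ sum (λ (i : Fin (m ℕ.+ n)) → f (s + + suc (toℕ i)))
    ≈⟨ R.+-congˡ (tail≋ (m ℕ.+ n)) ⟩
  f (s + 0ℤ) ⊕ segment f (s + 1ℤ) (m ℕ.+ n)
    ≈⟨ R.+-congˡ (segment-+ f (s + 1ℤ) m n) ⟩
  f (s + 0ℤ) ⊕ (segment f (s + 1ℤ) m ⊕ segment f (s + 1ℤ + + m) n)
    ≈⟨ R.+-assoc (f (s + 0ℤ)) _ _ ⟨
  f (s + 0ℤ) ⊕ segment f (s + 1ℤ) m ⊕ segment f (s + 1ℤ + + m) n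
    ≈⟨ R.+-cong (R.+-congˡ (R.sym (tail≋ m)))
         (R.reflexive (cong (λ t → segment f t n) (ℤ.+-assoc s 1ℤ (+ m)))) ⟩
  segment f s (suc m) ⊕ segment f (s + + suc m) n ∎
  where
  tail≋ : ∀ n → sum (λ (i : Fin n) → f (s + + suc (toℕ i))) ≋ segment f (s + 1ℤ) n
  tail≋ n = sum-cong-≋ {n} λ i →
    R.reflexive (cong f (≡.sym (ℤ.+-assoc s 1ℤ (+ toℕ i))))

segment-zero : ∀ f s n → (∀ i → i ℕ.< n → f (s + + i) ≋ 0B) → segment f s n ≋ 0B
segment-zero f s n f≋0 = sum-zero λ i → f≋0 (toℕ i) (Fin.toℕ<n i)

i≤+∣i∣ : ∀ i → i ≤ + ∣ i ∣
i≤+∣i∣ (+ n)    = ℤ.≤-refl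
i≤+∣i∣ -[1+ n ] = -≤+

-∣i∣≤i : ∀ i → - (+ ∣ i ∣) ≤ i
-∣i∣≤i i = subst₂ _≤_ (cong (λ n → - (+ n)) (ℤ.∣-i∣≡∣i∣ i)) (ℤ.neg-involutive i)
  (ℤ.neg-mono-≤ (i≤+∣i∣ (- i)))

i≤j⇒∃n : ∀ {i j} → i ≤ j → ∃[ n ] j ≡ i + + n
i≤j⇒∃n {i} {j} i≤j = ∣ j - i ∣ , ≡.trans (identity i j)
  (cong (λ t → i + t) (≡.sym (ℤ.0≤i⇒+∣i∣≡i (ℤ.i≤j⇒0≤j-i i≤j))))
  where
  identity : ∀ i j → j ≡ i + (j - i)
  identity = solve-∀

i<i+1+n : ∀ i n → i < i + + suc n
i<i+1+n i n = subst (_< i + + suc n) (ℤ.+-identityʳ i)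
  (ℤ.+-monoʳ-< i (+<+ (s≤s z≤n)))

-- The symmetric window demanded by `HasSum` is cut at `s` and after `q`; the two outer pieces
-- vanish.
HasSum-interval : ∀ f s q →
  (∀ p → p < s → f p ≋ 0B) → (∀ p → q < p → f p ≋ 0B) →
  ∀ n → s + + n ≡ q → HasSum f (segment f s (suc n))
HasSum-interval f s q below above n s+n≡q = N , outside , total
  where
  N : ℕ
  -- Large enough for both ends `s` and `q` to lie between `- (+ N)` and `+ N`.
  N = ∣ s ∣ ℕ.+ ∣ q ∣

  -N≤s : - (+ N) ≤ s
  -N≤s = ℤ.≤-trans (ℤ.neg-mono-≤ (+≤+ (ℕ.m≤m+n ∣ s ∣ ∣ q ∣))) (-∣i∣≤i s)

  q≤N : q ≤ + N
  q≤N = ℤ.≤-trans (i≤+∣i∣ q) (+≤+ (ℕ.m≤n+m ∣ q ∣ ∣ s ∣))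

  outside : ∀ p → N ℕ.< ∣ p ∣ → f p ≋ 0B
  outside (+ p)    N<p = above (+ p) (ℤ.≤-<-trans q≤N (+<+ N<p))
  outside -[1+ p ] N<p =
    below -[1+ p ] (ℤ.<-≤-trans (ℤ.neg-mono-< (+<+ N<p)) -N≤s)

  total : sum {suc (N ℕ.+ N)} (λ i → f (+ toℕ i - + N)) ≋ segment f s (suc n)
  total with i≤j⇒∃n -N≤s | i≤j⇒∃n q≤N
  -- `k` and `m` are the lengths of the pieces below `s` and above `q`.
  ... | k , s≡-N+k | m , N≡q+m = begin
    sum {suc (N ℕ.+ N)} (λ i → f (+ toℕ i - + N))
      ≈⟨ sum-cong-≋ {suc (N ℕ.+ N)} (λ i →
           R.reflexive (cong f (ℤ.+-comm (+ toℕ i) (- (+ N))))) ⟩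
    segment f (- (+ N)) (suc (N ℕ.+ N))
      ≈⟨ R.reflexive (cong (segment f (- (+ N))) length≡) ⟩
    segment f (- (+ N)) (k ℕ.+ (suc n ℕ.+ m))
      ≈⟨ segment-+ f (- (+ N)) k (suc n ℕ.+ m) ⟩
    segment f (- (+ N)) k ⊕ segment f (- (+ N) + + k) (suc n ℕ.+ m)
      ≈⟨ R.+-cong (segment-zero f (- (+ N)) k λ i i<k → below _
           (subst (- (+ N) + + i <_) (≡.sym s≡-N+k)
             (ℤ.+-monoʳ-< (- (+ N)) (+<+ i<k))))
           (R.reflexive (cong (λ t → segment f t (suc n ℕ.+ m)) (≡.sym s≡-N+k))) ⟩
    0B ⊕ segment f s (suc n ℕ.+ m)
      ≈⟨ R.+-identityˡ _ ⟩
    segment f s (suc n ℕ.+ m)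
      ≈⟨ segment-+ f s (suc n) m ⟩
    segment f s (suc n) ⊕ segment f (s + + suc n) m
      ≈⟨ R.+-congˡ {x = segment f s (suc n)}
           (segment-zero f (s + + suc n) m λ i _ → above _
             (subst₂ _<_ s+n≡q (≡.sym (after s (+ n) (+ i)))
               (i<i+1+n (s + + n) i))) ⟩
    segment f s (suc n) ⊕ 0B
      ≈⟨ R.+-identityʳ _ ⟩
    segment f s (suc n) ∎
    where
    after : ∀ s n i → s + (1ℤ + n) + i ≡ s + n + (1ℤ + i)
    after = solve-∀

    -- Proved in ℤ, where one of the two copies of `N` can be replaced by `- N + k + n + m`.
    length≡ : suc (N ℕ.+ N) ≡ k ℕ.+ (suc n ℕ.+ m)
    length≡ = ℤ.+-injective (≡.trans
      (cong (λ t → 1ℤ + (+ N + t))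
        (≡.trans N≡q+m (cong (λ t → t + + m) (≡.trans (≡.sym s+n≡q) (cong (λ t → t + + n) s≡-N+k)))))
      (identity (+ N) (+ k) (+ n) (+ m)))
      where
      identity : ∀ N k n m → 1ℤ + (N + (- N + k + n + m)) ≡ k + (1ℤ + n + m)
      identity = solve-∀

HasSum-cong : ∀ {f x y} → x ≋ y → HasSum f x → HasSum f y
HasSum-cong x≋y (N , outside , total) = N , outside , R.trans total x≋y

-- The Hessenberg determinants and their expansion.

e-negative : ∀ h p a → p - a < 0ℤ → e h p a ≋ 0B
e-negative h p a p<a with p - a
... | -[1+ _ ] = R.refl
e-negative h p a (+<+ ()) | + _

module _ (h : ℤ → ℤ → B)
         (unit   : ∀ k → h k (- k) ≋ 1B)
         (vanish : ∀ r k → k + r < 0ℤ → h r k ≋ 0B) where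

  -- The two indices of the entry at `i`, `j` add up to 1 + j - i: `unit` puts ones on the
  -- subdiagonal and `vanish` zeros below it. With the size as an argument, induction replaces the
  -- case distinction in `e`.
  E : ℤ → ℕ → B
  E p n = det {n} λ i j → h (p + 1ℤ + + toℕ j) (- (p + + toℕ i))

  e≋E : ∀ p a n → - p - a ≡ + n → e h (- p) a ≋ E p n
  -- `e` branches on this same difference, so after abstraction the equation selects the branch.
  e≋E p a n eq with - p - a
  e≋E p a zero    ≡.refl | .(+ zero)  = R.refl
  e≋E p a (suc n) ≡.refl | .(+ suc n) = det-cong {suc n} λ i j →
    R.reflexive (cong₂ h (column p (+ toℕ j)) (row p (+ toℕ i)))
    where
    column : ∀ p j → - - p + (1ℤ + j) ≡ p + 1ℤ + j
    column = solve-∀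
    row : ∀ p i → - p + 1ℤ - (1ℤ + i) ≡ - (p + i)
    row = solve-∀

  -- Induction on `j`. For `j` zero, deleting the first row and column only shifts `p` by one.
  -- Otherwise the first column of the minor is a subdiagonal one above zeros; stripping it leaves
  -- the minor for `p + 1ℤ` and the preceding column.
  E-minor : ∀ p n (j : Fin (suc n)) →
    det {n} (λ i k → h (p + 1ℤ + + toℕ (punchIn j k)) (- (p + + suc (toℕ i))))
    ≋ E (p + + suc (toℕ j)) (n ∸ toℕ j)
  E-minor p n zero = det-cong {n} λ i k →
    R.reflexive (cong₂ h (column p (+ toℕ k)) (row p (+ toℕ i)))
    where
    column : ∀ p k → p + 1ℤ + (1ℤ + k) ≡ p + 1ℤ + 1ℤ + k
    column = solve-∀
    row : ∀ p i → - (p + (1ℤ + i)) ≡ - (p + 1ℤ + i)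
    row = solve-∀
  E-minor p (suc n) (suc j) = begin
    det A
      ≈⟨ det-firstColumn A (λ i → vanish _ _ (subst (_< 0ℤ)
           (≡.sym (below p (+ toℕ i))) -<+)) ⟩
    A zero zero ⊗ D
      ≈⟨ R.*-congʳ {x = D} (R.trans
           (R.reflexive (cong (λ t → h t (- (p + 1ℤ))) (ℤ.+-identityʳ (p + 1ℤ))))
           (unit (p + 1ℤ))) ⟩
    1B ⊗ D
      ≈⟨ R.*-identityˡ D ⟩
    D
      ≈⟨ det-cong {n} (λ i k → R.reflexive (cong₂ h
           (column p (+ toℕ (punchIn j k))) (row p (+ suc (toℕ i))))) ⟩
    det (λ i k → h (p + 1ℤ + 1ℤ + + toℕ (punchIn j k)) (- (p + 1ℤ + + suc (toℕ i))))
      ≈⟨ E-minor (p + 1ℤ) n j ⟩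
    E (p + 1ℤ + + suc (toℕ j)) (n ∸ toℕ j)
      ≈⟨ R.reflexive (cong (λ t → E t (n ∸ toℕ j)) (ℤ.+-assoc p 1ℤ (+ suc (toℕ j)))) ⟩
    E (p + + suc (suc (toℕ j))) (n ∸ toℕ j) ∎
    where
    A : Fin (suc n) → Fin (suc n) → B
    A i k = h (p + 1ℤ + + toℕ (punchIn (suc j) k)) (- (p + + suc (toℕ i)))
    D : B
    D = det λ i k → A (suc i) (suc k)
    below : ∀ p i → - (p + (1ℤ + (1ℤ + i))) + (p + 1ℤ + 0ℤ) ≡ - (1ℤ + i)
    below = solve-∀
    column : ∀ p k → p + 1ℤ + (1ℤ + k) ≡ p + 1ℤ + 1ℤ + k
    column = solve-∀
    row : ∀ p i → - (p + (1ℤ + i)) ≡ - (p + 1ℤ + i)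
    row = solve-∀

  E-laplace : ∀ p n → E p (suc n) ≋ sum {suc n} λ j →
    sgn (+ toℕ j) ⊗
      (h (p + + suc (toℕ j)) (- p) ⊗ E (p + + suc (toℕ j)) (n ∸ toℕ j))
  E-laplace p n = sum-cong-≋ {suc n} λ j → R.*-congˡ {x = sgn (+ toℕ j)}
    (R.*-cong
      (R.reflexive (cong₂ h (ℤ.+-assoc p 1ℤ (+ toℕ j)) (cong -_ (ℤ.+-identityʳ p))))
      (E-minor p n j))

  -- The remaining sum is the first-row expansion of `E s (suc n)` with opposite sign, because
  -- `sgn (+ suc (toℕ j))` carries one more factor -1 than the cofactor sign.
  E-alternating : ∀ ε s n →
    ε ⊗ E s (suc n) ⊕ sum {suc n} (λ j → ε ⊗ sgn (+ suc (toℕ j)) ⊗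
      (h (s + + suc (toℕ j)) (- s) ⊗ E (s + + suc (toℕ j)) (n ∸ toℕ j))) ≋ 0B
  E-alternating ε s n = begin
    ε ⊗ E s (suc n) ⊕ sum (λ j → ε ⊗ sgn (+ suc (toℕ j)) ⊗ X j)
      ≈⟨ R.+-cong (R.*-congˡ {x = ε} (E-laplace s n)) (sum-cong-≋ flip) ⟩
    ε ⊗ S ⊕ sum (λ j → ⊖ ε ⊗ (sgn (+ toℕ j) ⊗ X j))
      ≈⟨ R.+-congˡ {x = ε ⊗ S} (*-distribˡ-sum (⊖ ε) (λ j → sgn (+ toℕ j) ⊗ X j)) ⟨
    ε ⊗ S ⊕ ⊖ ε ⊗ S
      ≈⟨ R.distribʳ S ε (⊖ ε) ⟨
    (ε ⊕ ⊖ ε) ⊗ S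
      ≈⟨ R.*-congʳ (R.-‿inverseʳ ε) ⟩
    0B ⊗ S
      ≈⟨ R.zeroˡ S ⟩
    0B ∎
    where
    X : Fin (suc n) → B
    X j = h (s + + suc (toℕ j)) (- s) ⊗ E (s + + suc (toℕ j)) (n ∸ toℕ j)
    S : B
    S = sum λ j → sgn (+ toℕ j) ⊗ X j
    flip : ∀ j → ε ⊗ sgn (+ suc (toℕ j)) ⊗ X j ≋ ⊖ ε ⊗ (sgn (+ toℕ j) ⊗ X j)
    flip j = begin
      ε ⊗ (⊖ 1B ⊗ σ) ⊗ X j  ≈⟨ R.*-congʳ (R.*-congˡ {x = ε} (-1*x≈-x σ)) ⟩
      ε ⊗ ⊖ σ ⊗ X j         ≈⟨ R.*-congʳ (-‿distribʳ-* ε σ) ⟨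
      ⊖ (ε ⊗ σ) ⊗ X j       ≈⟨ R.*-congʳ (-‿distribˡ-* ε σ) ⟩
      ⊖ ε ⊗ σ ⊗ X j         ≈⟨ R.*-assoc (⊖ ε) σ (X j) ⟩
      ⊖ ε ⊗ (σ ⊗ X j)       ∎
      where
      σ : B
      σ = sgn (+ toℕ j)

  -- Newton's identity, first on the supporting interval, then for all indices.

  -- With b = -s and a = -(s + n) the support is the interval of n + 1 integers from `s`. At p = s +
  -- i the elementary factor is `E` of size n - i, so the sum is a diagonal entry for n = 0 and an
  -- instance of `E-alternating` otherwise.
  newton-segment : ∀ s n → segment
    (λ p → sgn (- (s + + n) - p) ⊗ (h p (- s) ⊗ e h (- p) (- (s + + n))))
    s (suc n) ≋ δ (- (s + + n)) (- s)
  newton-segment s n = begin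
    segment f s (suc n)
      ≈⟨ sum-cong-≋ {suc n} (λ i → R.*-cong (sign i) (R.*-congˡ {x = h (s + + toℕ i) (- s)}
           (e≋E (s + + toℕ i) (- (s + + n)) (n ∸ toℕ i) (size i)))) ⟩
    sum {suc n} (λ i → ε n ⊗ sgn (+ toℕ i) ⊗
      (h (s + + toℕ i) (- s) ⊗ E (s + + toℕ i) (n ∸ toℕ i)))
      -- The term p = s is split off; its sign factor `sgn 0ℤ` and its entry `h s (- s)` are both 1.
      ≈⟨ R.+-congʳ (R.*-cong (R.*-identityʳ (ε n)) (R.trans
           (R.*-cong (R.trans (R.reflexive (cong (λ t → h t (- s)) (ℤ.+-identityʳ s))) (unit s))
             (R.reflexive (cong (λ t → E t n) (ℤ.+-identityʳ s))))
           (R.*-identityˡ (E s n)))) ⟩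
    ε n ⊗ E s n ⊕ sum {n} (λ j → ε n ⊗ sgn (+ suc (toℕ j)) ⊗
      (h (s + + suc (toℕ j)) (- s) ⊗ E (s + + suc (toℕ j)) (n ∸ suc (toℕ j))))
      ≈⟨ cases n ⟩
    δ (- (s + + n)) (- s) ∎
    where
    f : ℤ → B
    f p = sgn (- (s + + n) - p) ⊗ (h p (- s) ⊗ e h (- p) (- (s + + n)))

    -- The sign common to all terms, as a function of the length because `cases` splits on it.
    ε : ℕ → B
    ε n = sgn (- (s + + n) - s)

    sign : ∀ (i : Fin (suc n)) → sgn (- (s + + n) - (s + + toℕ i)) ≋ ε n ⊗ sgn (+ toℕ i)
    sign i = R.trans
      (R.reflexive (cong sgn (regroup (- (s + + n)) s (+ toℕ i))))
      (sgn-∸ (- (s + + n) - s) (toℕ i))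
      where
      regroup : ∀ a s i → a - (s + i) ≡ a - s - i
      regroup = solve-∀

    size : ∀ (i : Fin (suc n)) → - (s + + toℕ i) - - (s + + n) ≡ + (n ∸ toℕ i)
    size i = ≡.trans (difference s (+ toℕ i) (+ n))
      (≡.trans (ℤ.[+m]-[+n]≡m⊖n n (toℕ i)) (ℤ.⊖-≥ (Fin.toℕ≤pred[n] i)))
      where
      difference : ∀ s i n → - (s + i) - - (s + n) ≡ n - i
      difference = solve-∀

    cases : ∀ n → ε n ⊗ E s n ⊕ sum {n} (λ j → ε n ⊗ sgn (+ suc (toℕ j)) ⊗
      (h (s + + suc (toℕ j)) (- s) ⊗ E (s + + suc (toℕ j)) (n ∸ suc (toℕ j))))
      ≋ δ (- (s + + n)) (- s)
    cases zero = begin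
      ε 0 ⊗ 1B ⊕ 0B          ≈⟨ R.+-identityʳ (ε 0 ⊗ 1B) ⟩
      ε 0 ⊗ 1B               ≈⟨ R.*-identityʳ (ε 0) ⟩
      ε 0                    ≈⟨ R.reflexive (cong (λ t → sgn (- t - s)) (ℤ.+-identityʳ s)) ⟩
      sgn (- s - s)          ≈⟨ sgn-double (- s) ⟩
      1B                     ≈⟨ δ-≡ (cong -_ (ℤ.+-identityʳ s)) ⟨
      δ (- (s + 0ℤ)) (- s)   ∎
    cases (suc n) = R.trans (E-alternating (ε (suc n)) s n)
      (R.sym (δ-≢ (ℤ.<⇒≢ (ℤ.neg-mono-< (i<i+1+n s n)))))

  -- Together with `above` this bounds the support: under -b the indices of `h p b` have negative
  -- sum, and over -a the upper index of the elementary factor is less than its lower index.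
  below : ∀ a b p → p < - b → sgn (a - p) ⊗ (h p b ⊗ e h (- p) a) ≋ 0B
  below a b p p<-b = R.trans
    (R.*-congˡ {x = sgn (a - p)} (R.trans
      (R.*-congʳ {x = e h (- p) a}
        (vanish p b (subst (b + p <_) (ℤ.+-inverseʳ b) (ℤ.+-monoʳ-< b p<-b))))
      (R.zeroˡ (e h (- p) a))))
    (R.zeroʳ (sgn (a - p)))

  above : ∀ a b p → - a < p → sgn (a - p) ⊗ (h p b ⊗ e h (- p) a) ≋ 0B
  above a b p -a<p = R.trans
    (R.*-congˡ {x = sgn (a - p)} (R.trans
      (R.*-congˡ {x = h p b} (e-negative h (- p) a
        (subst (- p - a <_) (ℤ.+-inverseˡ p) (ℤ.+-monoʳ-< (- p) -a<p))))
      (R.zeroʳ (h p b))))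
    (R.zeroʳ (sgn (a - p)))

  newton : ∀ a b → HasSum (λ p → sgn (a - p) ⊗ (h p b ⊗ e h (- p) a)) (δ a b)
  newton a b with - b ℤ.≤? - a
  -- The interval from -b to -a is empty: each `p` lies below -b or above -a, so every term vanishes
  -- and `N` = 0 will do.
  ... | no -b≰-a = 0 , (λ p _ → zero-everywhere p) , total
    where
    f : ℤ → B
    f p = sgn (a - p) ⊗ (h p b ⊗ e h (- p) a)
    zero-everywhere : ∀ p → f p ≋ 0B
    zero-everywhere p with p ℤ.<? - b
    ... | yes p<-b = below a b p p<-b
    ... | no p≮-b  = above a b p (ℤ.<-≤-trans (ℤ.≰⇒> -b≰-a) (ℤ.≮⇒≥ p≮-b))
    total : sum {1} (λ i → f (+ toℕ i - 0ℤ)) ≋ δ a b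
    total = R.trans (sum-zero {1} λ i → zero-everywhere (+ toℕ i - 0ℤ))
      (R.sym (δ-≢ λ a≡b → -b≰-a (ℤ.≤-reflexive (cong -_ (≡.sym a≡b)))))
  ... | yes -b≤-a with i≤j⇒∃n -b≤-a
  ...   | n , -a≡-b+n = HasSum-cong
    -- The double negations from s = -b are removed; `b′` is kept apart from `b` so that the
    -- starting point `- b` stays fixed.
    (subst₂
      (λ a b′ → segment (λ p → sgn (a - p) ⊗ (h p b′ ⊗ e h (- p) a)) (- b) (suc n) ≋ δ a b′)
      (≡.trans (cong -_ (≡.sym -a≡-b+n)) (ℤ.neg-involutive a)) (ℤ.neg-involutive b)
      (newton-segment (- b) n))
    (HasSum-interval (λ p → sgn (a - p) ⊗ (h p b ⊗ e h (- p) a)) (- b) (- a)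
      (below a b) (above a b) n (≡.sym -a≡-b+n))

proposition3p1 : (h : ℤ → ℤ → B) → IsAdmissible h →
    (a b : ℤ) → HasSum (λ p → sgn (a - p) ⊗ (h p b ⊗ e h (- p) a)) (δ a b)
proposition3p1 h admissible = newton h unit vanish
  where open IsAdmissible admissible
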